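{- The pseudoachromatic index of $\mathrm{PG}(3,2)$ equals $18$: $\psi'(\mathrm{PG}(3,2))=18$.
   Context: $\mathrm{PG}(3,2)$ is the $3$-dimensional projective space over $\mathrm{GF}(2)$ (15 points, 35 lines). A coloring with $k$ colors is a surjective map from the set of lines to $\{1,\dots,k\}$. It is complete if for every pair of distinct colors there is a point lying on a line of each of the two colors. The pseudoachromatic index $\psi'$ is the largest $k$ for which a complete (not necessarily proper) coloring with $k$ colors exists. -}

module Defs where

open import Data.Bool using (Bool; true; false; _xor_; _∨_; _∧_; not; T; if_then_else_)
open import Data.Nat using (ℕ; zero; suc; _/_; _%_; _^_; _≡ᵇ_)
open import Data.Fin using (Fin; toℕ)
open import Data.Fin.Subset using (Subset; _∈_)
open import Data.Vec using (Vec; tabulate; zipWith; lookup; foldr)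
open import Data.Vec.Properties using (≡-dec)
open import Data.Bool.Properties using () renaming (_≟_ to _≟B_)
open import Data.List using (List; allFin)
open import Data.Bool.ListAction using (any)
open import Relation.Nullary.Decidable using (⌊_⌋)
open import Relation.Binary.PropositionalEquality using (_≡_; _≢_)
open import Data.Product using (Σ; Σ-syntax; ∃-syntax; _×_; _,_; proj₁)
open import Function.Definitions using (Surjective)

V : Set
V = Vec Bool 4

_+V_ : V → V → V
_+V_ = zipWith _xor_

_==V_ : V → V → Bool
u ==V v = ⌊ ≡-dec _≟B_ u v ⌋

isZero : V → Bool
isZero v = foldr _ (λ b acc → not b ∧ acc) true v

-- The 16 vectors of GF(2)^4 are indexed by Fin 16 via binary expansion.
-- bit j of n (least significant bit is bit 0)
bit : ℕ → ℕ → Bool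
bit n zero    = n % 2 ≡ᵇ 1
bit n (suc j) = bit (n / 2) j

vec : Fin 16 → V
vec i = tabulate (λ j → bit (toℕ i) (toℕ j))

-- Points of PG(3,2): the 1-dimensional subspaces of GF(2)^4, i.e. the
-- 15 nonzero vectors.
Point : Set
Point = Σ[ i ∈ Fin 16 ] T (not (isZero (vec i)))

span2 : Fin 16 → Fin 16 → Subset 16
span2 a b = tabulate (λ i → (vec i ==V vec a) ∨ (vec i ==V vec b) ∨ (vec i ==V (vec a +V vec b)))

-- S is (the point set of) a line iff S = {a, b, a+b} for distinct nonzero a, b,
-- i.e. S is the set of nonzero vectors of a 2-dimensional subspace.
isLine : Subset 16 → Bool
isLine S = any (λ a → any (λ b →
    not (isZero (vec a)) ∧ not (isZero (vec b)) ∧ not (vec a ==V vec b)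
    ∧ ⌊ ≡-dec _≟B_ S (span2 a b) ⌋) (allFin 16)) (allFin 16)

-- Lines of PG(3,2) (35 of them), identified with their point sets.
-- (T of a Bool is proof-irrelevant, so equal point sets give equal lines.)
Line : Set
Line = Σ[ S ∈ Subset 16 ] T (isLine S)

_I_ : Point → Line → Set
p I L = proj₁ p ∈ proj₁ L

record Coloring (k : ℕ) : Set where
  field
    colour     : Line → Fin k
    surjective : Surjective _≡_ _≡_ colour

Complete : {k : ℕ} → Coloring k → Set
Complete {k} c = (i j : Fin k) → i ≢ j →
  ∃[ p ] ∃[ L ] ∃[ M ] (Coloring.colour c L ≡ i × Coloring.colour c M ≡ j × p I L × p I M)

HasCompleteColoring : ℕ → Set
HasCompleteColoring k = Σ[ c ∈ Coloring k ] Complete c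

PseudoachromaticIndexIs : ℕ → Set
PseudoachromaticIndexIs n = HasCompleteColoring n × (∀ k → HasCompleteColoring k → k Data.Nat.≤ n)

{-# OPTIONS --safe #-}
module Submission where

-- Upper bound.  Merging colours, assume there are exactly 19.  As there are only 35 lines, at least
-- three lines are alone in their colour; they meet pairwise.  A line meets 18 others, so if it is
-- alone in its colour then the lines meeting it carry the 18 other colours once each.  Up to
-- collineations and correlations the three lines form a pencil or a star (three lines through a
-- point, not coplanar).  In a pencil, eight further lines are alone in their colours, and some of
-- them are skew.  In a star, no line of the star meets two lines of the same colour.  This pairs
-- each of the 12 "legs" (lines meeting two of the three) with a "mate" (a line meeting only the other
-- one), and leaves only the four "far" lines, which miss the star, to be added to these colours.
-- The third lines of the three pencils in the star need far lines in their own colours to meet all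
-- legs' colours.  At most one far line is left over, so all but one leg share their colour with the
-- mate only, and a search over the pairings shows that these colours cannot meet as required.

open import Defs

open import Data.Bool using (Bool; T; not; _∧_)
open import Data.Bool.ListAction using (any)
open import Data.Bool.Properties using (T?; T-≡; T-∧; T-irrelevant) renaming (_≟_ to _≟ᵇ_)
open import Data.Empty using (⊥; ⊥-elim)
open import Data.Fin as Fin using (Fin; #_; toℕ; fromℕ<; inject≤; _<_)
open import Data.Fin.Induction using (<-wellFounded)
import Data.Fin.Properties as Fin
open import Data.Fin.Properties
  using (_≟_; _<?_; all?; any?; toℕ-injective; toℕ-fromℕ<; toℕ-inject≤; toℕ<n; inject≤-injective)
open import Data.Fin.Subset using (Subset) renaming (_∈_ to _∈ˢ_)
open import Data.Fin.Subset.Properties using () renaming (_∈?_ to _∈ˢ?_)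
open import Data.List using (List; []; _∷_; _++_; allFin; filter; length; map; concatMap; lookup)
open import Data.List.Membership.Propositional using (_∈_; _∉_; find; lose)
open import Data.List.Membership.Propositional.Properties
  using (∈-lookup; ∈-allFin; ∈-filter⁺; ∈-filter⁻; ∈-map⁺; ∈-map⁻; ∈-++⁺ˡ; ∈-++⁺ʳ; ∈-concatMap⁺; ∈-concatMap⁻)
open import Data.List.Properties using (length-++; length-map; length-tabulate; filter-notAll)
open import Data.List.Relation.Unary.All as All using (All; []; _∷_)
import Data.List.Relation.Unary.All.Properties as All
open import Data.List.Relation.Unary.AllPairs using ([]; _∷_; allPairs?)
open import Data.List.Relation.Unary.Any as Any using (Any; here; there; index; satisfied)
open import Data.List.Relation.Unary.Any.Properties using (any⁺; any⁻; lookup-index)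
open import Data.List.Relation.Unary.Unique.Propositional using (Unique)
open import Data.List.Relation.Unary.Unique.Propositional.Properties using (++⁺; map⁺; filter⁺; allFin⁺)
open import Data.Nat as ℕ using (ℕ; _+_; _≤_; _≤?_; s≤s; _≡ᵇ_)
open import Data.Nat.DivMod using (_mod_)
import Data.Nat.Properties as ℕ
open import Data.Product using (∃; ∃₂; _×_; _,_; proj₁; proj₂)
open import Data.Sum using (_⊎_; inj₁; inj₂)
open import Data.Vec as Vec using (Vec; []; _∷_)
open import Data.Vec.Properties using (≡-dec; []=⇒lookup; lookup∘tabulate)
open import Function using (_∘_; id; Equivalence)
open import Induction.WellFounded using (Acc; acc)
open import Relation.Binary.PropositionalEquality
  using (_≡_; _≢_; refl; sym; trans; cong; subst; subst₂)
open import Relation.Nullary using (¬_; Dec; yes; no; ¬?; _×-dec_; _⊎-dec_; _→-dec_; contradiction)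
open import Relation.Nullary.Decidable using (from-yes; toWitness; decidable-stable; ⌊_⌋)

-- A model of the 35 lines, their incidence and their symmetries

Ix : Set
Ix = Fin 35

-- PG(3,2) has 35 lines, and they correspond to the splittings of {0,…,7} into two 4-sets in such a
-- way that two lines meet iff the splittings bisect each other.  The lines are listed in the
-- lexicographic order of the 4-set containing 0.
pointsOf : Ix → List ℕ
pointsOf = Vec.lookup (
  (1 ∷ 2 ∷ 3 ∷ []) ∷ (4 ∷ 8 ∷ 12 ∷ []) ∷ (5 ∷ 11 ∷ 14 ∷ []) ∷ (7 ∷ 10 ∷ 13 ∷ []) ∷ (6 ∷ 9 ∷ 15 ∷ []) ∷
  (5 ∷ 10 ∷ 15 ∷ []) ∷ (4 ∷ 9 ∷ 13 ∷ []) ∷ (6 ∷ 8 ∷ 14 ∷ []) ∷ (7 ∷ 11 ∷ 12 ∷ []) ∷ (1 ∷ 6 ∷ 7 ∷ []) ∷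
  (2 ∷ 9 ∷ 11 ∷ []) ∷ (3 ∷ 13 ∷ 14 ∷ []) ∷ (3 ∷ 12 ∷ 15 ∷ []) ∷ (2 ∷ 8 ∷ 10 ∷ []) ∷ (1 ∷ 4 ∷ 5 ∷ []) ∷
  (6 ∷ 11 ∷ 13 ∷ []) ∷ (7 ∷ 8 ∷ 15 ∷ []) ∷ (5 ∷ 9 ∷ 12 ∷ []) ∷ (4 ∷ 10 ∷ 14 ∷ []) ∷ (3 ∷ 9 ∷ 10 ∷ []) ∷
  (1 ∷ 14 ∷ 15 ∷ []) ∷ (2 ∷ 5 ∷ 7 ∷ []) ∷ (2 ∷ 4 ∷ 6 ∷ []) ∷ (1 ∷ 12 ∷ 13 ∷ []) ∷ (3 ∷ 8 ∷ 11 ∷ []) ∷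
  (2 ∷ 12 ∷ 14 ∷ []) ∷ (3 ∷ 4 ∷ 7 ∷ []) ∷ (1 ∷ 8 ∷ 9 ∷ []) ∷ (1 ∷ 10 ∷ 11 ∷ []) ∷ (3 ∷ 5 ∷ 6 ∷ []) ∷
  (2 ∷ 13 ∷ 15 ∷ []) ∷ (5 ∷ 8 ∷ 13 ∷ []) ∷ (4 ∷ 11 ∷ 15 ∷ []) ∷ (6 ∷ 10 ∷ 12 ∷ []) ∷ (7 ∷ 9 ∷ 14 ∷ []) ∷ [])

_∈ᵇ_ : ℕ → List ℕ → Bool
p ∈ᵇ ps = any (p ≡ᵇ_) ps

opaque
  meets : Ix → Ix → Bool
  meets i j = any (_∈ᵇ pointsOf j) (pointsOf i)

Meets : Ix → Ix → Set
Meets i j = T (meets i j)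

meets? : ∀ i j → Dec (Meets i j)
meets? i j = T? (meets i j)

-- The action of the transposition (s s+1) of {0,…,7}, which is a correlation of PG(3,2): it preserves
-- incidence of lines but exchanges stars with triangles.
swap : Fin 7 → Ix → Ix
swap s i = Vec.lookup (Vec.lookup table s) i mod 35
  where
  table : Vec (Vec ℕ 35) 7
  table =
    (0 ∷ 1 ∷ 2 ∷ 3 ∷ 4 ∷ 5 ∷ 6 ∷ 7 ∷ 8 ∷ 9 ∷ 10 ∷ 11 ∷ 12 ∷ 13 ∷ 14 ∷ 34 ∷ 33 ∷ 32 ∷ 31 ∷ 30 ∷ 29 ∷
     28 ∷ 27 ∷ 26 ∷ 25 ∷ 24 ∷ 23 ∷ 22 ∷ 21 ∷ 20 ∷ 19 ∷ 18 ∷ 17 ∷ 16 ∷ 15 ∷ []) ∷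
    (0 ∷ 1 ∷ 2 ∷ 3 ∷ 4 ∷ 15 ∷ 16 ∷ 17 ∷ 18 ∷ 19 ∷ 20 ∷ 21 ∷ 22 ∷ 23 ∷ 24 ∷ 5 ∷ 6 ∷ 7 ∷ 8 ∷ 9 ∷ 10 ∷
     11 ∷ 12 ∷ 13 ∷ 14 ∷ 25 ∷ 26 ∷ 27 ∷ 28 ∷ 29 ∷ 30 ∷ 31 ∷ 32 ∷ 33 ∷ 34 ∷ []) ∷
    (0 ∷ 5 ∷ 6 ∷ 7 ∷ 8 ∷ 1 ∷ 2 ∷ 3 ∷ 4 ∷ 9 ∷ 10 ∷ 11 ∷ 12 ∷ 13 ∷ 14 ∷ 15 ∷ 16 ∷ 17 ∷ 18 ∷ 25 ∷ 26 ∷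
     27 ∷ 28 ∷ 29 ∷ 30 ∷ 19 ∷ 20 ∷ 21 ∷ 22 ∷ 23 ∷ 24 ∷ 31 ∷ 32 ∷ 33 ∷ 34 ∷ []) ∷
    (1 ∷ 0 ∷ 2 ∷ 3 ∷ 4 ∷ 5 ∷ 9 ∷ 10 ∷ 11 ∷ 6 ∷ 7 ∷ 8 ∷ 12 ∷ 13 ∷ 14 ∷ 15 ∷ 19 ∷ 20 ∷ 21 ∷ 16 ∷ 17 ∷
     18 ∷ 22 ∷ 23 ∷ 24 ∷ 25 ∷ 26 ∷ 27 ∷ 31 ∷ 32 ∷ 33 ∷ 28 ∷ 29 ∷ 30 ∷ 34 ∷ []) ∷
    (0 ∷ 2 ∷ 1 ∷ 3 ∷ 4 ∷ 6 ∷ 5 ∷ 7 ∷ 8 ∷ 9 ∷ 12 ∷ 13 ∷ 10 ∷ 11 ∷ 14 ∷ 16 ∷ 15 ∷ 17 ∷ 18 ∷ 19 ∷ 22 ∷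
     23 ∷ 20 ∷ 21 ∷ 24 ∷ 25 ∷ 28 ∷ 29 ∷ 26 ∷ 27 ∷ 30 ∷ 31 ∷ 32 ∷ 34 ∷ 33 ∷ []) ∷
    (0 ∷ 1 ∷ 3 ∷ 2 ∷ 4 ∷ 5 ∷ 7 ∷ 6 ∷ 8 ∷ 10 ∷ 9 ∷ 11 ∷ 12 ∷ 14 ∷ 13 ∷ 15 ∷ 17 ∷ 16 ∷ 18 ∷ 20 ∷ 19 ∷
     21 ∷ 22 ∷ 24 ∷ 23 ∷ 26 ∷ 25 ∷ 27 ∷ 28 ∷ 30 ∷ 29 ∷ 31 ∷ 33 ∷ 32 ∷ 34 ∷ []) ∷
    (0 ∷ 1 ∷ 2 ∷ 4 ∷ 3 ∷ 5 ∷ 6 ∷ 8 ∷ 7 ∷ 9 ∷ 11 ∷ 10 ∷ 13 ∷ 12 ∷ 14 ∷ 15 ∷ 16 ∷ 18 ∷ 17 ∷ 19 ∷ 21 ∷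
     20 ∷ 23 ∷ 22 ∷ 24 ∷ 25 ∷ 27 ∷ 26 ∷ 29 ∷ 28 ∷ 30 ∷ 32 ∷ 31 ∷ 33 ∷ 34 ∷ []) ∷ []

swap-involutive : ∀ s i → swap s (swap s i) ≡ i
swap-involutive = from-yes (all? λ s → all? λ i → swap s (swap s i) ≟ i)

opaque
  unfolding meets

  swap-meets : ∀ s i j → Meets i j → Meets (swap s i) (swap s j)
  swap-meets = from-yes (all? λ s → all? λ i → all? λ j → meets? i j →-dec meets? (swap s i) (swap s j))

-- The pigeonhole principle for lists

lookup-distinct : ∀ {A : Set} {xs : List A} → Unique xs → ∀ {i j} → i < j → lookup xs i ≢ lookup xs j
lookup-distinct (x∉ ∷ u) {Fin.zero}  {Fin.suc j} _         = All.lookup x∉ (∈-lookup j)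
lookup-distinct (_ ∷ u)  {Fin.suc i} {Fin.suc j} (s≤s i<j) = lookup-distinct u i<j

-- The choice may depend on the membership proof, so positions in `xs` are sent to positions in
-- `ys`.
pigeonhole : ∀ {A B : Set} (R : A → B → Set) {xs : List A} {ys : List B} → Unique xs →
  length ys ℕ.< length xs → (∀ {x} → x ∈ xs → ∃ λ y → y ∈ ys × R x y) →
  ∃₂ λ x x′ → ∃ λ y → x ∈ xs × x′ ∈ xs × x ≢ x′ × R x y × R x′ y
pigeonhole R {xs} {ys} unique short choose =
  let i , j , i<j , eq = Fin.pigeonhole short (index ∘ mem)
  in lookup xs i , lookup xs j , val j , ∈-lookup i , ∈-lookup j , lookup-distinct unique i<j ,
     subst (R _) (trans (lookup-index (mem i)) (trans (cong (lookup ys) eq) (sym (lookup-index (mem j))))) (rel i) ,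
     rel j
  where
  val : Fin (length xs) → _
  val i = proj₁ (choose (∈-lookup i))
  mem : ∀ i → val i ∈ ys
  mem i = proj₁ (proj₂ (choose (∈-lookup i)))
  rel : ∀ i → R (lookup xs i) (val i)
  rel i = proj₂ (proj₂ (choose (∈-lookup i)))

unique-⊆⇒length≤ : ∀ {A : Set} {xs ys : List A} → Unique xs → (∀ {x} → x ∈ xs → x ∈ ys) → length xs ≤ length ys
unique-⊆⇒length≤ {xs = xs} {ys} unique xs⊆ys with length xs ℕ.≤? length ys
... | yes xs≤ys = xs≤ys
... | no  xs≰ys with pigeonhole _≡_ unique (ℕ.≰⇒> xs≰ys) (λ x∈ → _ , xs⊆ys x∈ , refl)
...   | _ , _ , _ , _ , _ , x≢x′ , refl , refl = contradiction refl x≢x′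

length-allFin : ∀ n → length (allFin n) ≡ n
length-allFin n = length-tabulate id

missing : ∀ {n} (xs : List (Fin n)) → length xs ℕ.< n → ∃ λ i → i ∉ xs
missing {n} xs short with any? (λ i → ¬? (Any.any? (i ≟_) xs))
... | yes found = found
... | no  none  = contradiction
  (subst (_≤ length xs) (length-allFin n) (unique-⊆⇒length≤ (allFin⁺ n) λ {i} _ → all∈ i))
  (ℕ.<⇒≱ short)
  where
  all∈ : ∀ i → i ∈ xs
  all∈ i with Any.any? (i ≟_) xs
  ... | yes i∈ = i∈
  ... | no  i∉ = contradiction (i , i∉) none

-- Colours carried by a single line

Solo : ∀ {m n} → (Fin m → Fin n) → Fin m → Set
Solo f x = ∀ y → f y ≡ f x → y ≡ x

module _ {m n} (f : Fin m → Fin n) (g : Fin n → Fin m) (f∘g : ∀ i → f (g i) ≡ i) where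

  private
    spare? : ∀ x → Dec (g (f x) ≢ x)
    spare? x = ¬? (g (f x) ≟ x)

    spare : List (Fin m)
    spare = filter spare? (allFin m)

    g-injective : ∀ {i j} → g i ≡ g j → i ≡ j
    g-injective {i} {j} eq = trans (sym (f∘g i)) (trans (cong f eq) (f∘g j))

    n+spare≤m : n + length spare ≤ m
    n+spare≤m = ℕ.≤-trans (ℕ.≤-reflexive (sym length-xs))
      (subst (length xs ≤_) (length-allFin m) (unique-⊆⇒length≤ xs-unique (λ _ → ∈-allFin _)))
      where
      xs : List (Fin m)
      xs = map g (allFin n) ++ spare
      length-xs : length xs ≡ n + length spare
      length-xs = trans (length-++ (map g (allFin n)))
        (cong (_+ length spare) (trans (length-map g (allFin n)) (length-allFin n)))
      xs-unique : Unique xs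
      xs-unique = ++⁺ (map⁺ g-injective (allFin⁺ n)) (filter⁺ spare? (allFin⁺ m)) λ (x∈g , x∈spare) →
        let i , _ , x≡gi = ∈-map⁻ g x∈g
        in proj₂ (∈-filter⁻ spare? {xs = allFin m} x∈spare)
             (trans (cong (g ∘ f) x≡gi) (trans (cong g (f∘g i)) (sym x≡gi)))

  -- A second line `y` of colour `i` would differ from `g (f y)`, so it would be spare and `i` a
  -- spare line's colour.
  unspared-solo : ∀ i → i ∉ map f spare → Solo f (g i)
  unspared-solo i i∉ y fy≡ with spare? y
  ... | yes y-spare = contradiction
    (subst (_∈ map f spare) (trans fy≡ (f∘g i)) (∈-map⁺ f (∈-filter⁺ spare? (∈-allFin y) y-spare))) i∉
  ... | no ¬spare with g (f y) ≟ y
  ...   | yes gfy≡y = trans (sym gfy≡y) (cong g (trans fy≡ (f∘g i)))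
  ...   | no  gfy≢y = contradiction gfy≢y ¬spare

  -- At most `m - n` elements are spare, so at least `n - (m - n) ≥ 3` colours contain none of them.
  three-solos : 3 + m ≤ n + n → ∃₂ λ x y → ∃ λ z →
    x ≢ y × x ≢ z × y ≢ z × Solo f x × Solo f y × Solo f z
  three-solos 3+m≤2n =
    let i , i∉ = missing cs (ℕ.≤-trans (ℕ.m≤n+m _ 2) enough)
        j , j∉ = missing (i ∷ cs) (ℕ.≤-trans (ℕ.n≤1+n _) enough)
        k , k∉ = missing (j ∷ i ∷ cs) enough
    in g i , g j , g k ,
       (λ eq → j∉ (here (sym (g-injective eq)))) ,
       (λ eq → k∉ (there (here (sym (g-injective eq))))) ,
       (λ eq → k∉ (here (sym (g-injective eq)))) ,
       unspared-solo i i∉ , unspared-solo j (j∉ ∘ there) , unspared-solo k (k∉ ∘ there ∘ there)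
    where
    cs : List (Fin n)
    cs = map f spare
    enough : 3 + length cs ≤ n
    enough = ℕ.+-cancelˡ-≤ n _ _ (begin
      n + (3 + length cs)    ≡⟨ cong (λ l → n + (3 + l)) (length-map f spare) ⟩
      n + (3 + length spare) ≡⟨ ℕ.+-comm n (3 + length spare) ⟩
      3 + length spare + n   ≡⟨ cong (3 +_) (ℕ.+-comm (length spare) n) ⟩
      3 + (n + length spare) ≤⟨ ℕ.+-monoʳ-≤ 3 n+spare≤m ⟩
      3 + m                  ≤⟨ 3+m≤2n ⟩
      n + n                  ∎)
      where open ℕ.≤-Reasoning

-- Compatibility and the lines around a star

-- If the lines of S are alone in their colours, lines of equal colour are compatible.
Compatible : List Ix → Ix → Ix → Set
Compatible S x y = All (λ s → Meets s x → Meets s y → x ≡ y) S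

compatible? : ∀ S x y → Dec (Compatible S x y)
compatible? S x y = All.all? (λ s → meets? s x →-dec (meets? s y →-dec (x ≟ y))) S

-- The lines span⟨1,2⟩, span⟨1,6⟩, span⟨1,14⟩ through the point 1.
star : List Ix
star = # 0 ∷ # 9 ∷ # 20 ∷ []

LegOff : Ix → Ix → Set
LegOff s z = All (λ t → meets t z ≡ not ⌊ t ≟ s ⌋) star

legOff? : ∀ s z → Dec (LegOff s z)
legOff? s z = All.all? (λ t → meets t z ≟ᵇ not ⌊ t ≟ s ⌋) star

opaque
  legsOff : Ix → List Ix
  legsOff s = filter (legOff? s) (allFin 35)

  ∈-legsOff⁻ : ∀ {s z} → z ∈ legsOff s → LegOff s z
  ∈-legsOff⁻ {s} z∈ = proj₂ (∈-filter⁻ (legOff? s) {xs = allFin 35} z∈)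

Opposite : Ix → Ix → Set
Opposite z w = All (λ s → meets s w ≡ not (meets s z)) star

opposite? : ∀ z w → Dec (Opposite z w)
opposite? z w = All.all? (λ s → meets s w ≟ᵇ not (meets s z)) star

opaque
  opposites : Ix → List Ix
  opposites z = filter (opposite? z) (allFin 35)

  ∈-opposites⁺ : ∀ {z w} → Opposite z w → w ∈ opposites z
  ∈-opposites⁺ {z} {w} = ∈-filter⁺ (opposite? z) (∈-allFin w)

-- The third lines of the pencils spanned by two lines of the star.
thirds : List Ix
thirds = # 14 ∷ # 23 ∷ # 27 ∷ []

-- The lines missing all three lines of the star.
far : List Ix
far = # 1 ∷ # 6 ∷ # 17 ∷ # 31 ∷ []

-- The search over pairings of legs with mates

-- A leg, the line of the star it misses, and the line outside far sharing its colour.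
record Edge : Set where
  constructor edge
  field
    side leg mate : Ix

open Edge

Touch : Edge → Edge → Set
Touch e e′ = Meets (leg e) (leg e′) ⊎ Meets (leg e) (mate e′) ⊎ Meets (mate e) (leg e′) ⊎ Meets (mate e) (mate e′)

Reaches : Ix → Edge → Set
Reaches q e = Meets q (leg e) ⊎ Meets q (mate e)

reaches? : ∀ q e → Dec (Reaches q e)
reaches? q e = meets? q (leg e) ⊎-dec meets? q (mate e)

-- The last condition: the colours of two thirds g, h must meet those of e and e′ in far lines.  Were
-- no far line common to both, g and h would use up all four, leaving none for the remaining third.
Fit : Edge → Edge → Set
Fit e e′ = (leg e ≡ leg e′ ⊎ mate e ≢ mate e′) × Touch e e′ ×
  (side e ≡ side e′ → Any (λ q → Reaches q e × Reaches q e′) far)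

fit? : ∀ e e′ → Dec (Fit e e′)
fit? e e′ = ((leg e ≟ leg e′) ⊎-dec ¬? (mate e ≟ mate e′))
  ×-dec (meets? (leg e) (leg e′) ⊎-dec meets? (leg e) (mate e′) ⊎-dec
         meets? (mate e) (leg e′) ⊎-dec meets? (mate e) (mate e′))
  ×-dec ((side e ≟ side e′) →-dec Any.any? (λ q → reaches? q e ×-dec reaches? q e′) far)

Variable : Set
Variable = Ix × Ix × List Ix

-- A failed backtracking search: `es` holds the edges chosen so far, and a branch is followed only
-- while the new edge fits all of them. Running out of variables would be a success, hence `⊥`.
Refuted : List Edge → List Variable → Set
Refuted es []                  = ⊥
Refuted es ((s , z , ws) ∷ vs) = All (λ w → All (Fit (edge s z w)) es → Refuted (edge s z w ∷ es) vs) ws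

refuted? : ∀ es vs → Dec (Refuted es vs)
refuted? es []                  = no λ ()
refuted? es ((s , z , ws) ∷ vs) =
  All.all? (λ w → All.all? (fit? (edge s z w)) es →-dec refuted? (edge s z w ∷ es) vs) ws

legs : List Ix
legs = concatMap legsOff star

-- The leg y is left out: a far line may have its colour.
variablesOff : Ix → Ix → List Variable
variablesOff y s = map (λ z → s , z , opposites z) (filter (λ z → ¬? (z ≟ y)) (legsOff s))

variables : Ix → List Variable
variables y = concatMap (variablesOff y) star

opaque
  unfolding meets legsOff opposites

  -- The excepted leg is not known in advance, so each of the twelve is tried; the other eleven have
  -- four candidate mates each.
  exhausted : All (λ y → Refuted [] (variables y)) legs
  exhausted = from-yes (All.all? (λ y → refuted? [] (variables y)) legs)

-- Colourings with 19 colours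

Colouring : Set
Colouring = Ix → Fin 19

AllMeet : Colouring → Set
AllMeet f = ∀ i j → i ≢ j → ∃₂ λ x y → f x ≡ i × f y ≡ j × Meets x y

opaque
  unfolding meets

  -- meets-refl makes the line itself one of its 19 neighbours.
  neighbours : Ix → List Ix
  neighbours ℓ = filter (meets? ℓ) (allFin 35)

  neighbours-length : ∀ ℓ → length (neighbours ℓ) ≡ 19
  neighbours-length = from-yes (all? λ ℓ → length (neighbours ℓ) ℕ.≟ 19)

  ∈-neighbours⁺ : ∀ {ℓ x} → Meets ℓ x → x ∈ neighbours ℓ
  ∈-neighbours⁺ {ℓ} {x} = ∈-filter⁺ (meets? ℓ) (∈-allFin x)

opaque
  unfolding meets

  meets-refl : ∀ ℓ → Meets ℓ ℓ
  meets-refl = from-yes (all? λ ℓ → meets? ℓ ℓ)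

-- The good edges single out one branch; it is never cut, because they fit each other, and so it
-- reaches the empty case.
refuted-sound : (Good : Edge → Set) → (∀ {e e′} → Good e → Good e′ → Fit e e′) →
  ∀ {es vs} → Refuted es vs → All Good es →
  All (λ (s , z , ws) → ∃ λ w → w ∈ ws × Good (edge s z w)) vs → ⊥
refuted-sound Good fits {vs = v ∷ vs} refuted goods ((w , w∈ws , good) ∷ vars) =
  refuted-sound Good fits (All.lookup refuted w∈ws (All.map (fits good) goods)) (good ∷ goods) vars

-- Incidence facts around a star and a pencil

opaque
  unfolding meets legsOff opposites

  -- `w` meets `s` and `z` does not, so they differ; compatibility then keeps `w` off the two star
  -- lines that `z` meets.
  opposite-mate : ∀ z w → All (λ s → LegOff s z → Meets s w → Compatible star z w → Opposite z w) star
  opposite-mate = from-yes (all? λ z → all? λ w → All.all? (λ s →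
    legOff? s z →-dec (meets? s w →-dec (compatible? star z w →-dec opposite? z w))) star)

  -- Together `z` and `w` meet the whole star, so any other line compatible with both misses all of
  -- it.
  legs-class : All (λ z → All (λ w → ∀ x → Compatible star x z → Compatible star x w →
    x ≡ z ⊎ x ≡ w ⊎ x ∈ far) (opposites z)) legs
  legs-class = from-yes (All.all? (λ z → All.all? (λ w → all? λ x →
    compatible? star x z →-dec (compatible? star x w →-dec
    ((x ≟ z) ⊎-dec (x ≟ w) ⊎-dec Any.any? (x ≟_) far))) (opposites z)) legs)

  thirds-class : All (λ g → ∀ x → Compatible star x g → x ≡ g ⊎ x ∈ far) thirds
  thirds-class = from-yes (All.all? (λ g → all? λ x →
    compatible? star x g →-dec ((x ≟ g) ⊎-dec Any.any? (x ≟_) far)) thirds)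

  -- A leg meets two lines of the star and a third meets all three, so any two of these fifteen
  -- lines meet a common star line. Hence their colours are distinct.
  separated : All (λ x → All (λ y → Compatible star x y → x ≡ y) (thirds ++ legs)) (thirds ++ legs)
  separated = from-yes (All.all? (λ x → All.all? (λ y →
    compatible? star x y →-dec (x ≟ y)) (thirds ++ legs)) (thirds ++ legs))

  legs-unique : Unique legs
  legs-unique = from-yes (allPairs? (λ x y → ¬? (x ≟ y)) legs)

  legsMissedBy : Ix → List Ix
  legsMissedBy g = filter (λ z → ¬? (meets? g z)) legs

  ∈-legsMissedBy⁻ : ∀ {g z} → z ∈ legsMissedBy g → z ∈ legs × ¬ Meets g z
  ∈-legsMissedBy⁻ {g} = ∈-filter⁻ (λ z → ¬? (meets? g z)) {xs = legs}

  legsMissedBy-unique : ∀ g → Unique (legsMissedBy g)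
  legsMissedBy-unique g = filter⁺ (λ z → ¬? (meets? g z)) legs-unique

  -- Let `g` lie in the pencil of the star lines a, b, and let `z` be a leg off a. A line opposite
  -- `z` meets a, but not at the common point; if it met `g` too, it would lie in the plane of a and
  -- b and meet b.
  third-misses : All (λ g → All (λ z → ¬ Meets g z → All (λ w → ¬ Meets g w) (opposites z)) legs) thirds
  third-misses = from-yes (All.all? (λ g → All.all? (λ z →
    ¬? (meets? g z) →-dec All.all? (λ w → ¬? (meets? g w)) (opposites z)) legs) thirds)

  -- Four against eight: `g` misses the four legs off each of the two star lines in its pencil.
  third-misses-many : All (λ g → length far ℕ.< length (legsMissedBy g)) thirds
  third-misses-many = from-yes (All.all? (λ g → length far ℕ.<? length (legsMissedBy g)) thirds)

  -- `g` and `h` are the thirds of the two pencils containing `s`. They meet the plane of the other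
  -- two star lines, where the legs off `s` lie, only in the common point of the star.
  two-thirds-miss : All (λ s → Any (λ g → Any (λ h → Any (λ k →
    g ≢ h × g ≢ k × h ≢ k × All (λ z → ¬ Meets g z × ¬ Meets h z) (legsOff s))
    thirds) thirds) thirds) star
  two-thirds-miss = from-yes (All.all? (λ s → Any.any? (λ g → Any.any? (λ h → Any.any? (λ k →
    ¬? (g ≟ h) ×-dec ¬? (g ≟ k) ×-dec ¬? (h ≟ k) ×-dec
    All.all? (λ z → ¬? (meets? g z) ×-dec ¬? (meets? h z)) (legsOff s))
    thirds) thirds) thirds) star)

  legs-apart : All (_∉ legs) thirds
  legs-apart = from-yes (All.all? (λ g → ¬? (Any.any? (g ≟_) legs)) thirds)

  4∈legs : # 4 ∈ legs
  4∈legs = from-yes (Any.any? (# 4 ≟_) legs)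

side-leg : ∀ {s z} → s ∈ star → z ∈ legsOff s → z ∈ legs
side-leg s∈ z∈ = ∈-concatMap⁺ legsOff (lose s∈ z∈)

∈-variables⁻ : ∀ {y s z ws} → (s , z , ws) ∈ variables y →
  s ∈ star × z ∈ legsOff s × z ≢ y × ws ≡ opposites z
∈-variables⁻ {y} v∈ with find (∈-concatMap⁻ (variablesOff y) {xs = star} v∈)
... | s , s∈ , v∈s with ∈-map⁻ (λ z → s , z , opposites z) v∈s
...   | z , z∈ , refl with ∈-filter⁻ (λ z → ¬? (z ≟ y)) {xs = legsOff s} z∈
...     | z∈s , z≢y = s∈ , z∈s , z≢y , refl

pencil : List Ix
pencil = # 0 ∷ # 9 ∷ # 14 ∷ []

opaque
  unfolding meets

  -- Every line meets some line of the pencil, and those through its centre or in its plane meet all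
  -- three. One through the centre but off the plane is skew to one in the plane but off the centre.
  pencil-skew : ∃₂ λ x y → ¬ Meets x y ×
    (∀ z → Compatible pencil z x → z ≡ x) × (∀ z → Compatible pencil z y → z ≡ y)
  pencil-skew = from-yes (any? λ x → any? λ y → ¬? (meets? x y) ×-dec
    all? (λ z → compatible? pencil z x →-dec (z ≟ x)) ×-dec
    all? (λ z → compatible? pencil z y →-dec (z ≟ y)))

-- Lines alone in their colours

module Upper (f : Colouring) (allMeet : AllMeet f) where

  solo-meets : ∀ {x y} → Solo f x → Solo f y → x ≢ y → Meets x y
  solo-meets {x} {y} soloX soloY x≢y with allMeet (f x) (f y) (x≢y ∘ soloY x)
  ... | a , b , fa , fb , a∼b with soloX a fa | soloY b fb
  ...   | refl | refl = a∼b

  neighbour-of-colour : ∀ {s} → Solo f s → ∀ i → ∃ λ y → Meets s y × f y ≡ i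
  neighbour-of-colour {s} solo i with f s ≟ i
  ... | yes fs≡i = s , meets-refl s , fs≡i
  ... | no  fs≢i with allMeet (f s) i fs≢i
  ...   | a , b , fa , fb , a∼b with solo a fa
  ...     | refl = b , a∼b , fb

  -- Without `y`, the 18 remaining neighbours of `s` would still carry all 19 colours, `x` standing
  -- in for `y`.
  rainbow : ∀ {s} → Solo f s → ∀ {x y} → f x ≡ f y → Meets s x → Meets s y → x ≡ y
  rainbow {s} solo {x} {y} fx≡fy s∼x s∼y with x ≟ y
  ... | yes x≡y = x≡y
  ... | no  x≢y =
    let _ , _ , _ , _ , _ , i≢j , fz≡i , fz≡j =
          pigeonhole (λ i z → f z ≡ i) (allFin⁺ 19) short (λ {i} _ → choose i)
    in contradiction (trans (sym fz≡i) fz≡j) i≢j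
    where
    ≢y? : ∀ z → Dec (z ≢ y)
    ≢y? z = ¬? (z ≟ y)
    others : List Ix
    others = filter ≢y? (neighbours s)
    short : length others ℕ.< 19
    short = subst (length others ℕ.<_) (neighbours-length s)
      (filter-notAll ≢y? (neighbours s) (lose (∈-neighbours⁺ s∼y) (λ y≢y → y≢y refl)))
    choose : ∀ i → ∃ λ z → z ∈ others × f z ≡ i
    choose i with neighbour-of-colour solo i
    ... | z , s∼z , fz with z ≟ y
    ...   | yes refl = x , ∈-filter⁺ ≢y? (∈-neighbours⁺ s∼x) x≢y , trans fx≡fy fz
    ...   | no  z≢y  = z , ∈-filter⁺ ≢y? (∈-neighbours⁺ s∼z) z≢y , fz

  compatible : ∀ {S} → All (Solo f) S → ∀ {x y} → f x ≡ f y → Compatible S x y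
  compatible solos fx≡fy = All.map (λ solo → rainbow solo fx≡fy) solos

  -- The star case

  module Star (solos : All (Solo f) star) where

    coloured-apart : ∀ {x y} → x ∈ thirds ++ legs → y ∈ thirds ++ legs → f x ≡ f y → x ≡ y
    coloured-apart x∈ y∈ fx≡fy = All.lookup (All.lookup separated x∈) y∈ (compatible solos fx≡fy)

    third : ∀ {g} → g ∈ thirds → g ∈ thirds ++ legs
    third = ∈-++⁺ˡ

    leg∈ : ∀ {z} → z ∈ legs → z ∈ thirds ++ legs
    leg∈ = ∈-++⁺ʳ thirds

    Free : Ix → Set
    Free z = All (λ q → f q ≢ f z) far

    free? : ∀ z → Dec (Free z)
    free? z = All.all? (λ q → ¬? (f q ≟ f z)) far

    unfree : ∀ {z} → ¬ Free z → ∃ λ q → q ∈ far × f q ≡ f z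
    unfree {z} ¬free with Any.any? (λ q → f q ≟ f z) far
    ... | yes found = find found
    ... | no  none  = contradiction (All.¬Any⇒All¬ far none) ¬free

    record Good (e : Edge) : Set where
      field
        side∈ : side e ∈ star
        leg∈side : leg e ∈ legsOff (side e)
        mate∈ : mate e ∈ opposites (leg e)
        matched : f (mate e) ≡ f (leg e)
        free : Free (leg e)

      leg∈legs : leg e ∈ legs
      leg∈legs = side-leg side∈ leg∈side

      class : ∀ {x} → f x ≡ f (leg e) → x ≡ leg e ⊎ x ≡ mate e
      class {x} fx≡ with All.lookup (All.lookup legs-class leg∈legs) mate∈ x
        (compatible solos fx≡) (compatible solos (trans fx≡ (sym matched)))
      ... | inj₁ x≡leg         = inj₁ x≡leg
      ... | inj₂ (inj₁ x≡mate) = inj₂ x≡mate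
      ... | inj₂ (inj₂ x∈far)  = contradiction fx≡ (All.lookup free x∈far)

    open Good

    -- Being alone in its colour, `s` must itself meet a line of the colour of `z`, which it misses;
    -- that line is the mate.
    mate-exists : ∀ {s z} → s ∈ star → z ∈ legsOff s → Free z → ∃ λ w → w ∈ opposites z × Good (edge s z w)
    mate-exists {s} {z} s∈ z∈ z-free with neighbour-of-colour (All.lookup solos s∈) (f z)
    ... | w , s∼w , fw = w , w∈ , record
      { side∈ = s∈ ; leg∈side = z∈ ; mate∈ = w∈ ; matched = fw ; free = z-free }
      where
      w∈ : w ∈ opposites z
      w∈ = ∈-opposites⁺ (All.lookup (opposite-mate z w) s∈ (∈-legsOff⁻ z∈) s∼w (compatible solos (sym fw)))

    -- `g` misses the mate along with the leg, so the two colours can only meet through a far line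
    -- coloured like `g`.
    third-reaches : ∀ {g e} → g ∈ thirds → Good e → ¬ Meets g (leg e) →
      ∃ λ q → q ∈ far × f q ≡ f g × Reaches q e
    third-reaches {g} {e} g∈ good g≁z
      with allMeet (f g) (f (leg e)) (λ eq → All.lookup legs-apart g∈
        (subst (_∈ legs) (sym (coloured-apart (third g∈) (leg∈ (leg∈legs good)) eq)) (leg∈legs good)))
    ... | x , y , fx , fy , x∼y with All.lookup thirds-class g∈ x (compatible solos fx) | class good fy
    ...   | inj₁ refl  | inj₁ refl = contradiction x∼y g≁z
    ...   | inj₁ refl  | inj₂ refl = contradiction x∼y
      (All.lookup (All.lookup (All.lookup third-misses g∈) (leg∈legs good) g≁z) (mate∈ good))
    ...   | inj₂ x∈far | inj₁ refl = x , x∈far , fx , inj₁ x∼y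
    ...   | inj₂ x∈far | inj₂ refl = x , x∈far , fx , inj₂ x∼y

    leg-side : ∀ {z} → z ∈ legs → ∃ λ s → s ∈ star × z ∈ legsOff s
    leg-side z∈ = find (∈-concatMap⁻ legsOff {xs = star} z∈)

    -- Otherwise each of the eight legs missed by `g` would need a far line of its own colour, and
    -- there are only four.
    third-far : ∀ {g} → g ∈ thirds → ∃ λ q → q ∈ far × f q ≡ f g
    third-far {g} g∈ with Any.any? (λ q → f q ≟ f g) far
    ... | yes found = find found
    ... | no  none  =
      let x , y , _ , x∈ , y∈ , x≢y , fq≡fx , fq≡fy =
            pigeonhole (λ z q → f q ≡ f z) (legsMissedBy-unique g) (All.lookup third-misses-many g∈) choose
          x≡y = coloured-apart (leg∈ (proj₁ (∈-legsMissedBy⁻ x∈))) (leg∈ (proj₁ (∈-legsMissedBy⁻ y∈)))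
                  (trans (sym fq≡fx) fq≡fy)
      in contradiction x≡y x≢y
      where
      choose : ∀ {z} → z ∈ legsMissedBy g → ∃ λ q → q ∈ far × f q ≡ f z
      choose {z} z∈ with free? z
      ... | no ¬free = unfree ¬free
      ... | yes z-free =
        let z∈legs , g≁z = ∈-legsMissedBy⁻ z∈
            s , s∈ , z∈s = leg-side z∈legs
            _ , _ , good = mate-exists s∈ z∈s z-free
            q , q∈ , fq , _ = third-reaches g∈ good g≁z
        in ⊥-elim (none (lose q∈ fq))

    -- The thirds take up three far lines in different colours; two unfree legs would bring this to
    -- five.
    unfree-unique : ∀ {y z} → y ∈ legs → z ∈ legs → ¬ Free y → ¬ Free z → y ≡ z
    unfree-unique {y} {z} y∈ z∈ ¬y ¬z with y ≟ z
    ... | yes y≡z = y≡z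
    ... | no  y≢z =
      let a , b , _ , a∈ , b∈ , a≢b , fq≡fa , fq≡fb =
            pigeonhole (λ x q → f q ≡ f x) unique (ℕ.n<1+n 4) choose
      in contradiction (coloured-apart (into a∈) (into b∈) (trans (sym fq≡fa) fq≡fb)) a≢b
      where
      apart : ∀ {x} → x ∈ legs → All (x ≢_) thirds
      apart x∈ = All.map (λ g∉ → λ { refl → g∉ x∈ }) legs-apart
      unique : Unique (y ∷ z ∷ thirds)
      unique = (y≢z ∷ apart y∈) ∷ apart z∈ ∷ from-yes (allPairs? (λ g h → ¬? (g ≟ h)) thirds)
      choose : ∀ {x} → x ∈ y ∷ z ∷ thirds → ∃ λ q → q ∈ far × f q ≡ f x
      choose (here refl)         = unfree ¬y
      choose (there (here refl)) = unfree ¬z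
      choose (there (there g∈))  = third-far g∈
      into : ∀ {x} → x ∈ y ∷ z ∷ thirds → x ∈ thirds ++ legs
      into (here refl)         = leg∈ y∈
      into (there (here refl)) = leg∈ z∈
      into (there (there g∈))  = third g∈

    touches : ∀ {e e′} → Good e → Good e′ → leg e ≢ leg e′ → Touch e e′
    touches {e} {e′} good good′ z≢z′
      with allMeet (f (leg e)) (f (leg e′))
             (z≢z′ ∘ coloured-apart (leg∈ (leg∈legs good)) (leg∈ (leg∈legs good′)))
    ... | x , y , fx , fy , x∼y with class good fx | class good′ fy
    ...   | inj₁ refl | inj₁ refl = inj₁ x∼y
    ...   | inj₁ refl | inj₂ refl = inj₂ (inj₁ x∼y)
    ...   | inj₂ refl | inj₁ refl = inj₂ (inj₂ (inj₁ x∼y))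
    ...   | inj₂ refl | inj₂ refl = inj₂ (inj₂ (inj₂ x∼y))

    commonly-reached : ∀ {e e′} → Good e → Good e′ → side e ≡ side e′ →
      Any (λ q → Reaches q e × Reaches q e′) far
    commonly-reached {e} {e′} good good′ refl
      with Any.any? (λ q → reaches? q e ×-dec reaches? q e′) far
    ... | yes found = found
    ... | no  none
      with g , g∈ , hs ← find (All.lookup two-thirds-miss (side∈ good))
      with h , h∈ , ks ← find hs
      with k , k∈ , g≢h , g≢k , h≢k , miss ← find ks
      with p , p∈ , fp , pe ← third-reaches g∈ good (proj₁ (All.lookup miss (leg∈side good)))
      with q , q∈ , fq , qe ← third-reaches h∈ good (proj₂ (All.lookup miss (leg∈side good)))
      with p′ , p′∈ , fp′ , p′e ← third-reaches g∈ good′ (proj₁ (All.lookup miss (leg∈side good′)))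
      with q′ , q′∈ , fq′ , q′e ← third-reaches h∈ good′ (proj₂ (All.lookup miss (leg∈side good′)))
      with r , r∈ , fr ← third-far k∈
      -- `p`, `q` lead to `e` and `p′`, `q′` to `e′`; with `r` they would be five distinct far
      -- lines.
      = contradiction (unique-⊆⇒length≤ unique (All.lookup inFar)) ℕ.1+n≰n
      where
      differ : ∀ {x y g h} → g ∈ thirds → h ∈ thirds → g ≢ h → f x ≡ f g → f y ≡ f h → x ≢ y
      differ g∈ h∈ g≢h fx fy refl = g≢h (coloured-apart (third g∈) (third h∈) (trans (sym fx) fy))
      clash : ∀ {x y} → x ∈ far → Reaches x e → Reaches y e′ → x ≢ y
      clash x∈ xe ye refl = none (lose x∈ (xe , ye))
      unique : Unique (p ∷ q ∷ p′ ∷ q′ ∷ r ∷ [])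
      unique =
        (differ g∈ h∈ g≢h fp fq ∷ clash p∈ pe p′e ∷ clash p∈ pe q′e ∷ differ g∈ k∈ g≢k fp fr ∷ []) ∷
        (clash q∈ qe p′e ∷ clash q∈ qe q′e ∷ differ h∈ k∈ h≢k fq fr ∷ []) ∷
        (differ g∈ h∈ g≢h fp′ fq′ ∷ differ g∈ k∈ g≢k fp′ fr ∷ []) ∷
        (differ h∈ k∈ h≢k fq′ fr ∷ []) ∷ [] ∷ []
      inFar : All (_∈ far) (p ∷ q ∷ p′ ∷ q′ ∷ r ∷ [])
      inFar = p∈ ∷ q∈ ∷ p′∈ ∷ q′∈ ∷ r∈ ∷ []

    fits : ∀ {e e′} → Good e → Good e′ → Fit e e′
    fits {e} {e′} good good′ with leg e ≟ leg e′
    -- `refuted-sound` compares arbitrary good edges; for equal legs, `Touch` holds because a line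
    -- meets itself.
    ... | yes z≡z′ = inj₁ z≡z′ , inj₁ (subst (Meets (leg e)) z≡z′ (meets-refl (leg e))) , commonly-reached good good′
    ... | no  z≢z′ = inj₂ mates-differ , touches good good′ z≢z′ , commonly-reached good good′
      where
      mates-differ : mate e ≢ mate e′
      mates-differ w≡w′ = z≢z′ (coloured-apart (leg∈ (leg∈legs good)) (leg∈ (leg∈legs good′))
        (trans (sym (matched good)) (trans (cong f w≡w′) (matched good′))))

    spoiler : ∃ λ y → y ∈ legs × (∀ {z} → z ∈ legs → z ≢ y → Free z)
    spoiler with Any.any? (λ z → ¬? (free? z)) legs
    ... | yes found =
      let y , y∈ , ¬y = find found
      in y , y∈ , λ {z} z∈ z≢y → decidable-stable (free? z) λ ¬z → z≢y (unfree-unique z∈ y∈ ¬z ¬y)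
    -- All legs are free, so the excepted leg is arbitrary.
    ... | no  none  =
      # 4 , 4∈legs , λ {z} z∈ _ → decidable-stable (free? z) (All.lookup (All.¬Any⇒All¬ legs none) z∈)

    impossible : ⊥
    impossible =
      let y , y∈ , others-free = spoiler
      in refuted-sound Good fits (All.lookup exhausted y∈) [] (All.tabulate (mates others-free))
      where
      mates : ∀ {y} → (∀ {z} → z ∈ legs → z ≢ y → Free z) → ∀ {v} → v ∈ variables y →
        let (s , z , ws) = v in ∃ λ w → w ∈ ws × Good (edge s z w)
      mates {y} others-free v∈ with ∈-variables⁻ v∈
      ... | s∈ , z∈ , z≢y , refl = mate-exists s∈ z∈ (others-free (side-leg s∈ z∈) z≢y)

  -- The pencil case

  pencil-impossible : All (Solo f) pencil → ⊥
  pencil-impossible solos =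
    let x , y , x≁y , x-alone , y-alone = pencil-skew
        a , b , fa , fb , a∼b = allMeet (f x) (f y) λ fx≡fy →
          x≁y (subst (Meets x) (y-alone x (compatible solos fx≡fy)) (meets-refl x))
    in x≁y (subst₂ Meets (x-alone a (compatible solos fa)) (y-alone b (compatible solos fb)) a∼b)

-- Reduction to normal forms under the symmetric group

descent : ∀ {n} (P : Fin n → Set) → (∀ x → P x ⊎ (∃ λ y → y < x × (P y → P x))) → ∀ x → P x
descent P step x = go x (<-wellFounded x)
  where
  go : ∀ x → Acc _<_ x → P x
  go x (acc rec) with step x
  ... | inj₁ px                = px
  ... | inj₂ (y , y<x , py⇒px) = py⇒px (go y (rec y<x))

record SoloTriple (f : Colouring) (x y z : Ix) : Set where
  field
    allMeet : AllMeet f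
    solo₁   : Solo f x
    solo₂   : Solo f y
    solo₃   : Solo f z
    x≢y     : x ≢ y
    x≢z     : x ≢ z
    y≢z     : y ≢ z

  open Upper f allMeet

  x∼y : Meets x y
  x∼y = solo-meets solo₁ solo₂ x≢y

  x∼z : Meets x z
  x∼z = solo-meets solo₁ solo₃ x≢z

  y∼z : Meets y z
  y∼z = solo-meets solo₂ solo₃ y≢z

open SoloTriple

-- All colourings at once, since a symmetry moves the colouring together with the lines.
Excluded : Ix → Ix → Ix → Set
Excluded x y z = ∀ f → ¬ SoloTriple f x y z

swap-injective : ∀ s {x y} → swap s x ≡ swap s y → x ≡ y
swap-injective s {x} {y} eq = trans (sym (swap-involutive s x)) (trans (cong (swap s) eq) (swap-involutive s y))

solo-swap : ∀ {f : Colouring} s {x} → Solo f x → Solo (f ∘ swap s) (swap s x)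
solo-swap {f} s {x} solo y fsy≡ = trans (sym (swap-involutive s y))
  (cong (swap s) (solo (swap s y) (trans fsy≡ (cong f (swap-involutive s x)))))

allMeet-swap : ∀ {f} s → AllMeet f → AllMeet (f ∘ swap s)
allMeet-swap {f} s allMeet i j i≢j =
  let x , y , fx , fy , x∼y = allMeet i j i≢j
  in swap s x , swap s y , trans (cong f (swap-involutive s x)) fx , trans (cong f (swap-involutive s y)) fy ,
     swap-meets s x y x∼y

excluded-swap : ∀ s {x y z} → Excluded (swap s x) (swap s y) (swap s z) → Excluded x y z
excluded-swap s excluded f t = excluded (f ∘ swap s) record
  { allMeet = allMeet-swap {f} s (allMeet t)
  ; solo₁   = solo-swap s (solo₁ t)
  ; solo₂   = solo-swap s (solo₂ t)
  ; solo₃   = solo-swap s (solo₃ t)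
  ; x≢y     = x≢y t ∘ swap-injective s
  ; x≢z     = x≢z t ∘ swap-injective s
  ; y≢z     = y≢z t ∘ swap-injective s
  }

opaque
  unfolding meets

  -- Adjacent transpositions sort any splitting into 0123|4567, the first in the list.
  lower₁ : ∀ x → x ≡ # 0 ⊎ (∃ λ s → swap s x < x)
  lower₁ = from-yes (all? λ x → (x ≟ # 0) ⊎-dec any? λ s → swap s x <? x)

  -- Such a splitting bisects 0123|4567; sorting within the two halves ends at 0145|2367, which is
  -- `# 9`.
  lower₂ : ∀ y → # 0 ≢ y → Meets (# 0) y → y ≡ # 9 ⊎ (∃ λ s → swap s y < y × swap s (# 0) ≡ # 0)
  lower₂ = from-yes (all? λ y → ¬? (# 0 ≟ y) →-dec (meets? (# 0) y →-dec
    ((y ≟ # 9) ⊎-dec any? λ s → (swap s y <? y) ×-dec (swap s (# 0) ≟ # 0))))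

  -- If 0 and 1 lie on the same side, `z` is 0167|2345, the line `# 14`. Otherwise it separates each
  -- of the pairs 01, 23, 45, 67 and sorts to 0246|1357, the line `# 20`.
  lower₃ : ∀ z → # 0 ≢ z → # 9 ≢ z → Meets (# 0) z → Meets (# 9) z →
    (z ≡ # 14 ⊎ z ≡ # 20) ⊎ (∃ λ s → swap s z < z × swap s (# 0) ≡ # 0 × swap s (# 9) ≡ # 9)
  lower₃ = from-yes (all? λ z → ¬? (# 0 ≟ z) →-dec (¬? (# 9 ≟ z) →-dec (meets? (# 0) z →-dec (meets? (# 9) z →-dec
    (((z ≟ # 14) ⊎-dec (z ≟ # 20)) ⊎-dec
    any? λ s → (swap s z <? z) ×-dec (swap s (# 0) ≟ # 0) ×-dec (swap s (# 9) ≟ # 9))))))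

no-triple-from-0-9 : ∀ z → Excluded (# 0) (# 9) z
no-triple-from-0-9 = descent (Excluded (# 0) (# 9)) step
  where
  step : ∀ z → Excluded (# 0) (# 9) z ⊎ (∃ λ z′ → z′ < z × (Excluded (# 0) (# 9) z′ → Excluded (# 0) (# 9) z))
  step z with (# 0) ≟ z | (# 9) ≟ z | meets? (# 0) z | meets? (# 9) z
  ... | yes 0≡z | _ | _ | _ = inj₁ λ f t → x≢z t 0≡z
  ... | no _ | yes 9≡z | _ | _ = inj₁ λ f t → y≢z t 9≡z
  ... | no _ | no _ | no 0≁z | _ = inj₁ λ f t → 0≁z (x∼z t)
  ... | no _ | no _ | yes _ | no 9≁z = inj₁ λ f t → 9≁z (y∼z t)
  ... | no 0≢z | no 9≢z | yes 0∼z | yes 9∼z with lower₃ z 0≢z 9≢z 0∼z 9∼z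
  ...   | inj₁ (inj₁ refl) = inj₁ λ f t →
    Upper.pencil-impossible f (allMeet t) (solo₁ t ∷ solo₂ t ∷ solo₃ t ∷ [])
  ...   | inj₁ (inj₂ refl) = inj₁ λ f t →
    Upper.Star.impossible f (allMeet t) (solo₁ t ∷ solo₂ t ∷ solo₃ t ∷ [])
  ...   | inj₂ (s , sz<z , s0 , s9) = inj₂ (swap s z , sz<z , λ excluded → excluded-swap s
    (subst₂ (λ x y → Excluded x y (swap s z)) (sym s0) (sym s9) excluded))

no-triple-from-0 : ∀ y z → Excluded (# 0) y z
no-triple-from-0 = descent (λ y → ∀ z → Excluded (# 0) y z) step
  where
  step : ∀ y → (∀ z → Excluded (# 0) y z) ⊎
    (∃ λ y′ → y′ < y × ((∀ z → Excluded (# 0) y′ z) → ∀ z → Excluded (# 0) y z))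
  step y with (# 0) ≟ y | meets? (# 0) y
  ... | yes 0≡y | _       = inj₁ λ z f t → x≢y t 0≡y
  ... | no _    | no 0≁y  = inj₁ λ z f t → 0≁y (x∼y t)
  ... | no 0≢y  | yes 0∼y with lower₂ y 0≢y 0∼y
  ...   | inj₁ refl            = inj₁ no-triple-from-0-9
  ...   | inj₂ (s , sy<y , s0) = inj₂ (swap s y , sy<y , λ excluded z → excluded-swap s
    (subst (λ x → Excluded x (swap s y) (swap s z)) (sym s0) (excluded (swap s z))))

no-triple : ∀ x y z → Excluded x y z
no-triple = descent (λ x → ∀ y z → Excluded x y z) step
  where
  step : ∀ x → (∀ y z → Excluded x y z) ⊎
    (∃ λ x′ → x′ < x × ((∀ y z → Excluded x′ y z) → ∀ y z → Excluded x y z))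
  step x with lower₁ x
  ... | inj₁ refl       = inj₁ no-triple-from-0
  ... | inj₂ (s , sx<x) = inj₂ (swap s x , sx<x , λ excluded y z →
    excluded-swap s (excluded (swap s y) (swap s z)))

¬allMeet : ∀ f → ¬ AllMeet f
¬allMeet f allMeet =
  -- `3 + 35 = 19 + 19`, so the count is tight.
  let _ , _ , _ , x≢y , x≢z , y≢z , sx , sy , sz = three-solos f g f∘g (from-yes (38 ≤? 38))
  in no-triple _ _ _ f record
    { allMeet = allMeet ; solo₁ = sx ; solo₂ = sy ; solo₃ = sz ; x≢y = x≢y ; x≢z = x≢z ; y≢z = y≢z }
  where
  preimage : ∀ i → ∃ λ x → f x ≡ i
  -- `AllMeet` only concerns pairs of distinct colours: colour 0 is paired with 1, every other
  -- colour with 0.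
  preimage i with i ≟ # 0
  ... | yes refl = let _ , y , _ , fy , _ = allMeet (# 1) (# 0) λ () in y , fy
  ... | no  i≢0  = let x , _ , fx , _ = allMeet i (# 0) i≢0 in x , fx
  g : Fin 19 → Ix
  g = proj₁ ∘ preimage
  f∘g : ∀ i → f (g i) ≡ i
  f∘g = proj₂ ∘ preimage

-- Comparison of the model with the lines of the projective space

_≟S_ : (S S′ : Subset 16) → Dec (S ≡ S′)
_≟S_ = ≡-dec _≟ᵇ_

pointSet : Ix → Subset 16
pointSet i = Vec.tabulate λ p → toℕ p ∈ᵇ pointsOf i

opaque
  pointSet-isLine : ∀ i → T (isLine (pointSet i))
  pointSet-isLine = from-yes (all? λ i → T? (isLine (pointSet i)))

  pointSet-injective : ∀ i j → pointSet i ≡ pointSet j → i ≡ j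
  pointSet-injective = from-yes (all? λ i → all? λ j → (pointSet i ≟S pointSet j) →-dec (i ≟ j))

  span2-listed : ∀ a b → T (not (isZero (vec a))) → T (not (isZero (vec b))) → T (not (vec a ==V vec b)) →
    ∃ λ i → pointSet i ≡ span2 a b
  span2-listed = from-yes (all? λ a → all? λ b →
    T? (not (isZero (vec a))) →-dec (T? (not (isZero (vec b))) →-dec (T? (not (vec a ==V vec b)) →-dec
    any? λ i → pointSet i ≟S span2 a b)))

opaque
  -- Extracting `a` and `b` first reduces the check to pairs of vectors instead of all subsets of
  -- the 16 vectors.
  listed : ∀ S → T (isLine S) → ∃ λ i → pointSet i ≡ S
  listed S line =
    let a , some-b = satisfied (any⁻ (λ a → any (spans a) (allFin 16)) (allFin 16) line)
        b , span   = satisfied (any⁻ (spans a) (allFin 16) some-b)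
    in from-span a b span
    where
    spans : Fin 16 → Fin 16 → Bool
    spans a b = not (isZero (vec a)) ∧ not (isZero (vec b)) ∧ not (vec a ==V vec b) ∧ ⌊ S ≟S span2 a b ⌋

    from-span : ∀ a b → T (spans a b) → ∃ λ i → pointSet i ≡ S
    from-span a b span =
      let a≢0 , rest = Equivalence.to (T-∧ {not (isZero (vec a))}) span
          b≢0 , rest = Equivalence.to (T-∧ {not (isZero (vec b))}) rest
          a≢b , S≡ab = Equivalence.to (T-∧ {not (vec a ==V vec b)}) rest
          i , i≡ab   = span2-listed a b a≢0 b≢0 a≢b
      in i , trans i≡ab (sym (toWitness {a? = S ≟S span2 a b} S≡ab))

toLine : Ix → Line
toLine i = pointSet i , pointSet-isLine i

fromLine : Line → Ix
fromLine (S , line) = proj₁ (listed S line)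

T-ext : ∀ {A : Set} (P : A → Bool) {x y : ∃ (T ∘ P)} → proj₁ x ≡ proj₁ y → x ≡ y
T-ext P {x , _} {_ , _} refl = cong (x ,_) (T-irrelevant {P x} _ _)

toLine-fromLine : ∀ L → toLine (fromLine L) ≡ L
toLine-fromLine (S , line) = T-ext isLine (proj₂ (listed S line))

fromLine-toLine : ∀ i → fromLine (toLine i) ≡ i
fromLine-toLine i = pointSet-injective _ _ (cong proj₁ (toLine-fromLine (toLine i)))

opaque
  unfolding meets

  common-point⇒meets : ∀ {p i j} → p ∈ˢ pointSet i → p ∈ˢ pointSet j → Meets i j
  common-point⇒meets {p} {i} {j} p∈i p∈j = any⁺ (_∈ᵇ pointsOf j)
    (Any.map (λ {q} p≡q → subst (λ q → T (q ∈ᵇ pointsOf j)) (ℕ.≡ᵇ⇒≡ (toℕ p) q p≡q) (on {j} p∈j))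
      (any⁻ (toℕ p ≡ᵇ_) (pointsOf i) (on {i} p∈i)))
    where
    on : ∀ {i} → p ∈ˢ pointSet i → T (toℕ p ∈ᵇ pointsOf i)
    on {i} p∈ = Equivalence.from T-≡ (trans (sym (lookup∘tabulate (λ p → toℕ p ∈ᵇ pointsOf i) p)) ([]=⇒lookup p∈))

  meets⇒common-point : ∀ i j → Meets i j → ∃ λ p → T (not (isZero (vec p))) × p ∈ˢ pointSet i × p ∈ˢ pointSet j
  meets⇒common-point = from-yes (all? λ i → all? λ j → meets? i j →-dec any? λ p →
    T? (not (isZero (vec p))) ×-dec (p ∈ˢ? pointSet i) ×-dec (p ∈ˢ? pointSet j))

-- A complete colouring with 18 colours

-- Fifteen classes are pairs, colour 14 has three lines, and `# 6` and `# 32`, which meet in the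
-- point 4, are alone in theirs.
colour₁₈ : Ix → Fin 18
colour₁₈ i = Vec.lookup table i mod 18
  where
  table : Vec ℕ 35
  table = 9 ∷ 9 ∷ 3 ∷ 10 ∷ 2 ∷ 15 ∷ 17 ∷ 7 ∷ 0 ∷ 8 ∷ 8 ∷ 14 ∷ 5 ∷ 6 ∷ 11 ∷ 4 ∷ 12 ∷ 12 ∷
          7 ∷ 3 ∷ 14 ∷ 2 ∷ 6 ∷ 15 ∷ 14 ∷ 13 ∷ 1 ∷ 5 ∷ 10 ∷ 4 ∷ 13 ∷ 0 ∷ 16 ∷ 1 ∷ 11 ∷ []

opaque
  unfolding meets

  colour₁₈-surjective : ∀ c → ∃ λ i → colour₁₈ i ≡ c
  colour₁₈-surjective = from-yes (all? λ c → any? λ i → colour₁₈ i ≟ c)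

  colour₁₈-complete : ∀ c d → c ≢ d → ∃ λ i → colour₁₈ i ≡ c × ∃ λ j → colour₁₈ j ≡ d × Meets i j
  colour₁₈-complete = from-yes (all? λ c → all? λ d → ¬? (c ≟ d) →-dec
    any? λ i → (colour₁₈ i ≟ c) ×-dec any? λ j → (colour₁₈ j ≟ d) ×-dec meets? i j)

hasCompleteColoring₁₈ : HasCompleteColoring 18
hasCompleteColoring₁₈ = coloring , complete
  where
  coloured : ∀ {i c} → colour₁₈ i ≡ c → colour₁₈ (fromLine (toLine i)) ≡ c
  coloured {i} fi = trans (cong colour₁₈ (fromLine-toLine i)) fi

  coloring : Coloring 18
  coloring = record
    { colour     = colour₁₈ ∘ fromLine
    ; surjective = λ c → let i , fi = colour₁₈-surjective c in toLine i , λ { refl → coloured fi }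
    }

  complete : Complete coloring
  complete c d c≢d =
    let i , fi , j , fj , i∼j = colour₁₈-complete c d c≢d
        p , p≢0 , p∈i , p∈j = meets⇒common-point i j i∼j
    in (p , p≢0) , toLine i , toLine j , coloured fi , coloured fj , p∈i , p∈j

-- Merging down to 19 colours

module _ {k} (19≤k : 19 ≤ k) where

  -- The colours from 19 on join colour 0. Enlarging a class does not stop it from meeting the
  -- others, so completeness survives.
  merge : Fin k → Fin 19
  merge c with toℕ c ℕ.<? 19
  ... | yes c<19 = fromℕ< c<19
  ... | no  _    = # 0

  merge-inject≤ : ∀ i → merge (inject≤ i 19≤k) ≡ i
  merge-inject≤ i with toℕ (inject≤ i 19≤k) ℕ.<? 19
  ... | yes i<19 = toℕ-injective (trans (toℕ-fromℕ< i<19) (toℕ-inject≤ i 19≤k))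
  ... | no  i≮19 = contradiction (subst (ℕ._< 19) (sym (toℕ-inject≤ i 19≤k)) (toℕ<n i)) i≮19

  merged : Coloring k → Colouring
  merged c = merge ∘ Coloring.colour c ∘ toLine

  merged-allMeet : (c : Coloring k) → Complete c → AllMeet (merged c)
  merged-allMeet c complete i j i≢j =
    let _ , L , M , cL , cM , p∈L , p∈M = complete (inject≤ i 19≤k) (inject≤ j 19≤k)
          (i≢j ∘ inject≤-injective 19≤k 19≤k i j)
    in fromLine L , fromLine M , colour-merged i cL , colour-merged j cM ,
       common-point⇒meets (on L p∈L) (on M p∈M)
    where
    open Coloring c
    colour-merged : ∀ i {L} → colour L ≡ inject≤ i 19≤k → merge (colour (toLine (fromLine L))) ≡ i
    colour-merged i {L} cL = trans (cong (merge ∘ colour) (toLine-fromLine L)) (trans (cong merge cL) (merge-inject≤ i))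
    on : ∀ L {p} → p ∈ˢ proj₁ L → p ∈ˢ pointSet (fromLine L)
    on L p∈L = subst (λ L → _ ∈ˢ proj₁ L) (sym (toLine-fromLine L)) p∈L

theorem6 : PseudoachromaticIndexIs 18
theorem6 = hasCompleteColoring₁₈ , bounded
  where
  bounded : ∀ k → HasCompleteColoring k → k ≤ 18
  bounded k (c , complete) = ℕ.≮⇒≥ λ 18<k → ¬allMeet (merged 18<k c) (merged-allMeet 18<k c complete)
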